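{- Let $k\neq h$ be positive integers with $\gcd(k,h)=1$ and let $n\ne 2$ be a positive integer. Then $$\mathcal{Z}(n,k,h)=\begin{cases}\Phi_n(k,h) & \text{if } n\neq p^zP_p(k,h) \text{ for every prime } p \text{ and every positive integer } z,\\[4pt] \dfrac{\Phi_n(k,h)}{p} & \text{if } n=p^zP_p(k,h) \text{ for some prime } p \text{ and some positive integer } z.\end{cases}$$
   Context: For positive integers $k,h,N$, the primitive index $P_N(k,h)$ is the least positive integer $u$ such that $N\mid k^u-h^u$ (if such a $u$ exists). A primitive prime divisor of the term $k^n-h^n$ is a prime $p$ dividing it with $P_p(k,h)=n$. The Zsigmondy number $\mathcal{Z}(n,k,h)$ is the product of the primitive prime divisors of $k^n-h^n$, counted with the multiplicity with which they divide $k^n-h^n$ (empty product $=1$). The homogenized cyclotomic polynomial values are defined recursively by $\Phi_n(k,h)=\dfrac{k^n-h^n}{\prod_{d\mid n,\,d<n}\Phi_d(k,h)}$.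
   Formalization: For n = 1 and k < h the printed equality fails by a sign (Φ_1 = k − h < 0 while 𝒵 = h − k > 0; e.g. k = 1, h = 2 gives 1 versus −1); there the formal statement allows 𝒵 = −Φ_1 instead. All other cases are as printed. -}

module Defs where

open import Data.Fin.Base using (Fin; toℕ)
open import Data.Fin.Properties using (toℕ<n)
open import Data.Integer.Base using (ℤ; +_; ∣_∣; _-_)
import Data.Integer.Divisibility as ℤ
open import Data.List.Base using (List; []; map; filter; foldr; allFin)
open import Data.List.Properties using (map-cong)
open import Data.Nat.Base using (ℕ; zero; suc; _^_; _<_)
open import Data.Nat.Divisibility using (_∣?_)
open import Data.Nat.Induction using (<-rec; <-Rec; <-wellFounded)
open import Data.Nat.ListAction using (product)
open import Data.Nat.Primality using (Prime; prime?)
open import Data.Nat.Primality.Factorisation using (factorise; factors)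
open import Data.Nat.Properties using (_<?_; allUpTo?)
open import Data.Product.Base using (_×_)
open import Data.Rational.Base using (ℚ; 0ℚ; 1ℚ; _*_; _÷_; ≢-nonZero)
open import Data.Rational.Literals using (fromℤ)
import Data.Rational.Properties as ℚ
open import Induction.WellFounded using (module FixPoint)
open import Relation.Binary.PropositionalEquality using (_≡_; cong)
open import Relation.Nullary using (Dec; yes; no; ¬_; ¬?; _×-dec_; _→-dec_)

term : (n k h : ℕ) → ℤ
term n k h = + (k ^ n) - + (h ^ n)

-- P_N(k,h) = u, as a relation because P_N(k,h) need not exist.
IsPrimitiveIndex : (N k h u : ℕ) → Set
IsPrimitiveIndex N k h u =
  0 < u × + N ℤ.∣ term u k h × (∀ {v} → v < u → 0 < v → ¬ (+ N ℤ.∣ term v k h))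

isPrimitiveIndex? : ∀ N k h u → Dec (IsPrimitiveIndex N k h u)
isPrimitiveIndex? N k h u =
  (0 <? u) ×-dec (N ∣? ∣ term u k h ∣) ×-dec
  allUpTo? (λ v → (0 <? v) →-dec ¬? (N ∣? ∣ term v k h ∣)) u

PrimitivePrimeDivisor : (n k h p : ℕ) → Set
PrimitivePrimeDivisor n k h p =
  Prime p × + p ℤ.∣ term n k h × IsPrimitiveIndex p k h n

primitivePrimeDivisor? : ∀ n k h p → Dec (PrimitivePrimeDivisor n k h p)
primitivePrimeDivisor? n k h p =
  prime? p ×-dec (p ∣? ∣ term n k h ∣) ×-dec isPrimitiveIndex? p k h n

-- Each prime is listed as often as it divides the argument. The value at 0 is
-- a dummy: term n k h ≢ 0 whenever 0 < n and k ≢ h.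
primeFactors : ℕ → List ℕ
primeFactors zero      = []
primeFactors m@(suc _) = factors (factorise m)

𝒵 : (n k h : ℕ) → ℕ
𝒵 n k h = product (filter (primitivePrimeDivisor? n k h) (primeFactors ∣ term n k h ∣))

-- Division made total by x ÷₀ 0 = 0.
infixl 7 _÷₀_
_÷₀_ : ℚ → ℚ → ℚ
x ÷₀ y with y ℚ.≟ 0ℚ
... | yes _   = 0ℚ
... | no y≢0  = (x ÷ y) {{≢-nonZero y≢0}}

productℚ : List ℚ → ℚ
productℚ = foldr _*_ 1ℚ

-- For 0 < n these are exactly the positive divisors of n below n, since 0 ∤ n.
properDivisors : (n : ℕ) → List (Fin n)
properDivisors n = filter (λ d → toℕ d ∣? n) (allFin n)

Φ-step : (k h n : ℕ) → <-Rec (λ _ → ℚ) n → ℚ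
Φ-step k h n Φ< =
  fromℤ (term n k h) ÷₀ productℚ (map (λ d → Φ< (toℕ<n d)) (properDivisors n))

-- Φ n k h is Φ_n(k,h). It is taken in ℚ so that the quotient in the recursion
-- is exact without knowing beforehand that the values are integers. For 0 < n
-- and k ≢ h no denominator vanishes.
Φ : (n k h : ℕ) → ℚ
Φ n k h = <-rec (λ _ → ℚ) (Φ-step k h) n

Φ-unfold : ∀ n k h →
  Φ n k h ≡ fromℤ (term n k h) ÷₀ productℚ (map (λ d → Φ (toℕ d) k h) (properDivisors n))
Φ-unfold n k h = FixPoint.unfold-wfRec <-wellFounded (λ _ → ℚ) (Φ-step k h)
  (λ m eq → cong (λ ds → fromℤ (term m k h) ÷₀ productℚ ds)
                 (map-cong (λ d → eq (toℕ<n d)) (properDivisors m))) {n}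

{-# OPTIONS --safe #-}

-- For a prime p with index u = P_p(k,h), p divides k^n − h^n exactly when u ∣ n,
-- and lifting the exponent computes how often along u, p u, p² u, …: factors
-- prime to p change nothing, and each further factor p contributes one more p,
-- except possibly from n = 1 to n = 2 when p = 2. Möbius inversion along this
-- chain shows that Φ_n(k,h) contains p as often as k^n − h^n does if n = u,
-- exactly once if n = p^z u with z > 0 and n ≠ 2, and not at all otherwise. So
-- 𝒵(n,k,h) and Φ_n(k,h) agree up to those p with n = p^z u. There is at most one
-- such p: for two of them, each would divide the index of the other, although
-- the index of a prime is smaller than the prime.
module Submission where

open import Defs
open import Data.Bool.Base using (if_then_else_)
open import Data.Fin.Base as Fin using (Fin; toℕ; fromℕ<)
open import Data.Fin.Properties using (toℕ<n; pigeonhole; fromℕ<-injective)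
open import Data.Integer.Base as ℤ using (ℤ; +_; ∣_∣; 0ℤ)
import Data.Integer.Properties as ℤ
open import Data.List.Base using (List; []; _∷_; _++_; length; map; filter; allFin; tabulate)
open import Data.List.Membership.Propositional using (_∈_)
open import Data.List.Properties using (filter-++; length-++; filter-accept; filter-reject; map-cong-local)
open import Data.List.Relation.Binary.Permutation.Propositional using (_↭_)
open import Data.List.Relation.Binary.Permutation.Propositional.Properties using (↭-length; filter-↭)
open import Data.List.Relation.Unary.All as All using (All; []; _∷_)
open import Data.List.Relation.Unary.All.Properties using (filter⁺; all-filter; tabulate⁺; ++⁺)
open import Data.List.Relation.Unary.Any using (here; there)
open import Data.Nat.Base
open import Data.Nat.Divisibility
open import Data.Nat.DivMod using (_%_; _/_; m%n<n; m≡m%n+[m/n]*n)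
open import Data.Nat.GCD using (gcd; gcd-comm; gcd-greatest)
open import Data.Nat.Induction using (<-rec)
open import Data.Nat.ListAction using (sum; product)
open import Data.Nat.ListAction.Properties using (product-++; ∈⇒∣product)
open import Data.Nat.Primality
open import Data.Nat.Primality.Factorisation using (PrimeFactorisation; factorise; factorisationUnique)
open import Data.Nat.Properties
open import Data.Nat.Tactic.RingSolver using (solve-∀)
open import Data.Product.Base using (_×_; _,_; proj₁; proj₂; ∃; ∃₂; -,_)
open import Data.Rational.Base as ℚ using (ℚ; 0ℚ; 1ℚ; ↥_; -_)
open import Data.Rational.Literals using (fromℤ)
import Data.Rational.Properties as ℚ
open import Data.Sum.Base using (_⊎_; inj₁; inj₂; [_,_]′)
open import Function.Base using (_∘_; id; it)
open import Relation.Binary.PropositionalEquality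
open import Relation.Nullary
open import Relation.Nullary.Decidable using (dec-true; dec-false)
open import Relation.Unary using (Decidable)

-- Exponents of primes in natural numbers

count : ℕ → List ℕ → ℕ
count p = length ∘ filter (p ≟_)

-- The exponent of p in m when p is prime and m ≢ 0; ν p 0 is 0.
ν : ℕ → ℕ → ℕ
ν p m = count p (primeFactors m)

count-++ : ∀ p ms ns → count p (ms ++ ns) ≡ count p ms + count p ns
count-++ p ms ns = trans (cong length (filter-++ (p ≟_) ms ns)) (length-++ (filter (p ≟_) ms))

count-here : ∀ m ms → count m (m ∷ ms) ≡ suc (count m ms)
count-here m ms = cong length (filter-accept (m ≟_) refl)

count-there : ∀ {p m} → p ≢ m → ∀ ms → count p (m ∷ ms) ≡ count p ms
count-there {p} p≢m ms = cong length (filter-reject (p ≟_) p≢m)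

count-filter : ∀ {P : ℕ → Set} (P? : Decidable P) {p} → P p → ∀ ms → count p (filter P? ms) ≡ count p ms
count-filter P? Pp [] = refl
count-filter P? {p} Pp (m ∷ ms) with p ≟ m
... | yes refl = begin
  count m (filter P? (m ∷ ms)) ≡⟨ cong (count m) (filter-accept P? Pp) ⟩
  count m (m ∷ filter P? ms)   ≡⟨ count-here m (filter P? ms) ⟩
  suc (count m (filter P? ms)) ≡⟨ cong suc (count-filter P? Pp ms) ⟩
  suc (count m ms)             ≡⟨ count-here m ms ⟨
  count m (m ∷ ms)             ∎
  where open ≡-Reasoning
... | no p≢m = trans (drop (P? m)) (trans (count-filter P? Pp ms) (sym (count-there p≢m ms)))
  where
  drop : Dec _ → count p (filter P? (m ∷ ms)) ≡ count p (filter P? ms)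
  drop (yes Pm) = trans (cong (count p) (filter-accept P? Pm)) (count-there p≢m (filter P? ms))
  drop (no ¬Pm) = cong (count p) (filter-reject P? ¬Pm)

count-filter-∌ : ∀ {P : ℕ → Set} (P? : Decidable P) {p} → ¬ P p → ∀ ms → count p (filter P? ms) ≡ 0
count-filter-∌ P? ¬Pp [] = refl
count-filter-∌ P? {p} ¬Pp (m ∷ ms) with P? m
... | no _ = count-filter-∌ P? ¬Pp ms
... | yes Pm = trans (count-there (λ where refl → ¬Pp Pm) (filter P? ms)) (count-filter-∌ P? ¬Pp ms)

count≢0⇒∈ : ∀ {p} ms → count p ms ≢ 0 → p ∈ ms
count≢0⇒∈ [] c≢0 = contradiction refl c≢0
count≢0⇒∈ {p} (m ∷ ms) c≢0 with p ≟ m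
... | yes p≡m = here p≡m
... | no p≢m  = there (count≢0⇒∈ ms λ c≡0 → c≢0 (trans (count-there p≢m ms) c≡0))

primeFactors-prime : ∀ m → All Prime (primeFactors m)
primeFactors-prime zero      = []
primeFactors-prime m@(suc _) = PrimeFactorisation.factorsPrime (factorise m)

product-primeFactors : ∀ m .{{_ : NonZero m}} → product (primeFactors m) ≡ m
product-primeFactors m@(suc _) = sym (PrimeFactorisation.isFactorisation (factorise m))

primeFactors-unique : ∀ {m} .{{_ : NonZero m}} (f : PrimeFactorisation m) →
                      primeFactors m ↭ PrimeFactorisation.factors f
primeFactors-unique {m@(suc _)} f = factorisationUnique (factorise m) f

-- Unique factorisation: `ms` is a permutation of `primeFactors (product ms)`, and counting ignores
-- the order.
ν-product : ∀ p {ms} → All Prime ms → ν p (product ms) ≡ count p ms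
ν-product p {ms} primes = ↭-length (filter-↭ (p ≟_) (primeFactors-unique {{productOfPrimes≢0 primes}}
  record { factors = ms ; isFactorisation = refl ; factorsPrime = primes }))

ν-* : ∀ p m n .{{_ : NonZero m}} .{{_ : NonZero n}} → ν p (m * n) ≡ ν p m + ν p n
ν-* p m n = begin
  ν p (m * n)                                                ≡⟨ cong (ν p) (cong₂ _*_ (product-primeFactors m) (product-primeFactors n)) ⟨
  ν p (product (primeFactors m) * product (primeFactors n))  ≡⟨ cong (ν p) (product-++ (primeFactors m) (primeFactors n)) ⟨
  ν p (product (primeFactors m ++ primeFactors n))           ≡⟨ ν-product p (++⁺ (primeFactors-prime m) (primeFactors-prime n)) ⟩
  count p (primeFactors m ++ primeFactors n)                 ≡⟨ count-++ p (primeFactors m) (primeFactors n) ⟩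
  ν p m + ν p n                                              ∎
  where open ≡-Reasoning

-- Both facts come from one induction, since `ν-*` requires the product over the tail to be nonzero.
ν-map : ∀ p {A : Set} (g : A → ℕ) xs → All (NonZero ∘ g) xs →
        NonZero (product (map g xs)) × ν p (product (map g xs)) ≡ sum (map (ν p ∘ g) xs)
ν-map p g []       []         = _ , refl
ν-map p g (x ∷ xs) (nz ∷ nzs) with nz′ , eq ← ν-map p g xs nzs =
  m*n≢0 (g x) _ {{nz}} {{nz′}} , trans (ν-* p (g x) _ {{nz}} {{nz′}}) (cong (λ # → ν p (g x) + #) eq)

ν-self : ∀ {p} → Prime p → ν p p ≡ 1
ν-self {p} pr = begin
  ν p p            ≡⟨ cong (ν p) (*-identityʳ p) ⟨
  ν p (p * 1)      ≡⟨ ν-product p (pr ∷ []) ⟩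
  count p (p ∷ []) ≡⟨ count-here p [] ⟩
  1                ∎
  where open ≡-Reasoning

ν≢0⇒∣ : ∀ {p} m → ν p m ≢ 0 → p ∣ m
ν≢0⇒∣ zero      _   = _ ∣0
ν≢0⇒∣ m@(suc _) ν≢0 = subst (_ ∣_) (product-primeFactors m) (∈⇒∣product (count≢0⇒∈ (primeFactors m) ν≢0))

∤⇒ν≡0 : ∀ {p} m → p ∤ m → ν p m ≡ 0
∤⇒ν≡0 {p} m p∤m with ν p m ≟ 0
... | yes eq = eq
... | no ν≢0 = contradiction (ν≢0⇒∣ m ν≢0) p∤m

ν-mono-∣ : ∀ p {m n} .{{_ : NonZero n}} → m ∣ n → ν p m ≤ ν p n
ν-mono-∣ p {m} {n} m∣n = begin
  ν p m                       ≤⟨ m≤m+n (ν p m) _ ⟩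
  ν p m + ν p (quotient m∣n)  ≡⟨ ν-* p m _ ⟨
  ν p (m * quotient m∣n)      ≡⟨ cong (ν p) (m∣n⇒n≡m*quotient m∣n) ⟨
  ν p n                       ∎
  where
  open ≤-Reasoning
  instance
    q≢0 = quotient≢0 m∣n
    m≢0 = m*n≢0⇒n≢0 (quotient m∣n) {{≢-nonZero (subst (_≢ 0) (m∣n⇒n≡quotient*m m∣n) (≢-nonZero⁻¹ n))}}

prime∣prime⇒≡ : ∀ {p q} → Prime p → Prime q → p ∣ q → p ≡ q
prime∣prime⇒≡ pp pq p∣q with prime⇒irreducible pq p∣q
... | inj₁ refl = contradiction pp ¬prime[1]
... | inj₂ eq   = eq

-- The primes of `m` are split off one at a time. Each such `q` has positive exponent in `n`, hence
-- divides it, and cancelling `q` on both sides preserves the inequalities of exponents.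
ν≤⇒∣ : ∀ m n .{{_ : NonZero m}} .{{_ : NonZero n}} → (∀ p → Prime p → ν p m ≤ ν p n) → m ∣ n
ν≤⇒∣ m n ν≤ = subst (_∣ n) (product-primeFactors m)
  (go (primeFactors-prime m) n λ p pp →
    ≤-trans (≤-reflexive (cong (ν p) (product-primeFactors m))) (ν≤ p pp))
  where
  go : ∀ {ps} → All Prime ps → ∀ n .{{_ : NonZero n}} → (∀ p → Prime p → ν p (product ps) ≤ ν p n) → product ps ∣ n
  go []                   n _  = 1∣ n
  go {q ∷ qs} (qp ∷ qsp) n ν≤ = begin
    q * product qs ∣⟨ *-monoʳ-∣ q (go qsp c λ p pp → +-cancelˡ-≤ (ν p q) _ _ (ν-cofactor p pp)) ⟩
    q * c          ≡⟨ n≡q*c ⟨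
    n              ∎
    where
    open ∣-Reasoning
    module ≤ = ≤-Reasoning
    instance
      q≢0 = prime⇒nonZero qp
      Πqs≢0 = productOfPrimes≢0 qsp
    1≤ν : 1 ≤ ν q n
    1≤ν = ≤.begin
      1                        ≤.≤⟨ m≤m+n 1 _ ⟩
      1 + ν q (product qs)     ≤.≡⟨ cong (_+ ν q (product qs)) (ν-self qp) ⟨
      ν q q + ν q (product qs) ≤.≡⟨ ν-* q q (product qs) ⟨
      ν q (q * product qs)     ≤.≤⟨ ν≤ q qp ⟩
      ν q n                    ≤.∎
    q∣n : q ∣ n
    q∣n = ν≢0⇒∣ n (≢-sym (<⇒≢ 1≤ν))
    c = quotient q∣n
    n≡q*c : n ≡ q * c
    n≡q*c = m∣n⇒n≡m*quotient q∣n
    instance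
      c≢0 = quotient≢0 q∣n
    ν-cofactor : ∀ p → Prime p → ν p q + ν p (product qs) ≤ ν p q + ν p c
    ν-cofactor p pp = ≤.begin
      ν p q + ν p (product qs) ≤.≡⟨ ν-* p q (product qs) ⟨
      ν p (q * product qs)     ≤.≤⟨ ν≤ p pp ⟩
      ν p n                    ≤.≡⟨ cong (ν p) n≡q*c ⟩
      ν p (q * c)              ≤.≡⟨ ν-* p q c ⟩
      ν p q + ν p c            ≤.∎

ν-injective : ∀ m n .{{_ : NonZero m}} .{{_ : NonZero n}} → (∀ p → Prime p → ν p m ≡ ν p n) → m ≡ n
ν-injective m n ν≡ = ∣-antisym (ν≤⇒∣ m n λ p pp → ≤-reflexive (ν≡ p pp))
                               (ν≤⇒∣ n m λ p pp → ≤-reflexive (sym (ν≡ p pp)))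

-- Truncated binomial expansions and lifting the exponent

-- The binomial coefficient of 2 + m over 2.
tri : ℕ → ℕ
tri zero    = 1
tri (suc m) = tri m + (2 + m)

2*tri : ∀ m → 2 * tri m ≡ (1 + m) * (2 + m)
2*tri zero    = refl
2*tri (suc m) = begin
  2 * (tri m + (2 + m))           ≡⟨ *-distribˡ-+ 2 (tri m) (2 + m) ⟩
  2 * tri m + 2 * (2 + m)         ≡⟨ cong (_+ 2 * (2 + m)) (2*tri m) ⟩
  (1 + m) * (2 + m) + 2 * (2 + m) ≡⟨ expand m ⟩
  (2 + m) * (3 + m)               ∎
  where
  open ≡-Reasoning
  expand : ∀ m → (1 + m) * (2 + m) + 2 * (2 + m) ≡ (2 + m) * (3 + m)
  expand = solve-∀

-- All that matters of the higher terms is their factor d², so the rest of them stays an unspecified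
-- `R`.
binomial₂ : ∀ x d m → ∃ λ R →
  (x + d) ^ (1 + m) ≡ x ^ (1 + m) + d * ((1 + m) * x ^ m + d * R)
binomial₂ x d zero = 0 , base x d
  where
  base : ∀ x d → (x + d) * 1 ≡ x * 1 + d * (1 * 1 + d * 0)
  base = solve-∀
binomial₂ x d (suc m) with R , eq ← binomial₂ x d m =
  -, trans (cong ((x + d) *_) eq) (expand x d (1 + m) (x ^ m) R)
  where
  expand : ∀ x d c y R → (x + d) * (x * y + d * (c * y + d * R)) ≡
    x * (x * y) + d * ((1 + c) * (x * y) + d * (x * R + c * y + d * R))
  expand = solve-∀

binomial₃ : ∀ x d m → ∃ λ R →
  (x + d) ^ (2 + m) ≡ x ^ (2 + m) + d * ((2 + m) * x ^ (1 + m) + d * (tri m * x ^ m + d * R))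
binomial₃ x d zero = 0 , base x d
  where
  base : ∀ x d → (x + d) * ((x + d) * 1) ≡ x * (x * 1) + d * (2 * (x * 1) + d * (1 * 1 + d * 0))
  base = solve-∀
binomial₃ x d (suc m) with R , eq ← binomial₃ x d m =
  -, trans (cong ((x + d) *_) eq) (expand x d (2 + m) (tri m) (x ^ m) R)
  where
  expand : ∀ x d c t y R → (x + d) * (x * (x * y) + d * (c * (x * y) + d * (t * y + d * R))) ≡
    x * (x * (x * y)) + d * ((1 + c) * (x * (x * y)) + d * ((t + c) * (x * y) + d * (x * R + t * y + d * R)))
  expand = solve-∀

square : ∀ x d → (x + d) ^ 2 ≡ x ^ 2 + d * (2 * x + d)
square = expand
  where
  expand : ∀ x d → (x + d) * ((x + d) * 1) ≡ x * (x * 1) + d * (2 * x + d)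
  expand = solve-∀

n<p^n : ∀ {p} → 1 < p → ∀ n → n < p ^ n
n<p^n 1<p zero    = s≤s z≤n
n<p^n 1<p (suc n) = ≤-<-trans (n<p^n 1<p n) (^-monoʳ-< _ 1<p (n<1+n n))

prime∣^⇒∣ : ∀ {p} → Prime p → ∀ x n → p ∣ x ^ n → p ∣ x
prime∣^⇒∣ pp x zero    p∣1 = ∣-trans p∣1 (1∣ x)
prime∣^⇒∣ pp x (suc n) p∣  = [ id , prime∣^⇒∣ pp x n ]′ (euclidsLemma x (x ^ n) pp p∣)

-- Lifting the exponent: A stands for (x + d)^m − x^m.
module _ {p x d} (pp : Prime p) (p∤x : p ∤ x) (p∣d : p ∣ d) .{{_ : NonZero d}} where

  private
    instance
      p≢0 = prime⇒nonZero pp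

    ∤⇒≢0 : ∀ m → p ∤ m → NonZero m
    ∤⇒≢0 m p∤m = ≢-nonZero λ where refl → p∤m (p ∣0)

  -- The expansion gives `A` as `d * Q` with `Q` congruent to m x^(m - 1) modulo p, and p divides
  -- neither m nor x.
  lifting-coprime : ∀ m {A} → p ∤ m → (x + d) ^ m ≡ x ^ m + A → ν p A ≡ ν p d
  lifting-coprime zero    p∤m eq = contradiction (p ∣0) p∤m
  lifting-coprime (suc m) {A} p∤m eq with R , exp ← binomial₂ x d m = begin
    ν p A                     ≡⟨ cong (ν p) (+-cancelˡ-≡ (x ^ suc m) _ _ (trans (sym eq) exp)) ⟩
    ν p (d * Q)               ≡⟨ ν-* p d Q {{it}} {{∤⇒≢0 Q p∤Q}} ⟩
    ν p d + ν p Q             ≡⟨ cong (λ # → ν p d + #) (∤⇒ν≡0 Q p∤Q) ⟩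
    ν p d + 0                 ≡⟨ +-identityʳ _ ⟩
    ν p d                     ∎
    where
    open ≡-Reasoning
    Q = suc m * x ^ m + d * R
    p∤Q : p ∤ Q
    p∤Q p∣Q = [ p∤m , p∤x ∘ prime∣^⇒∣ pp x m ]′
      (euclidsLemma (suc m) (x ^ m) pp (∣m+n∣m⇒∣n (subst (p ∣_) (+-comm (suc m * x ^ m) _) p∣Q) (∣m⇒∣m*n R p∣d)))

  private
    lifting-cofactor : ∀ {A} Q → p ∤ Q → A ≡ d * (p * Q) → ν p A ≡ suc (ν p d)
    lifting-cofactor {A} Q p∤Q eq = begin
      ν p A                     ≡⟨ cong (ν p) eq ⟩
      ν p (d * (p * Q))         ≡⟨ ν-* p d (p * Q) ⟩
      ν p d + ν p (p * Q)       ≡⟨ cong (λ # → ν p d + #) (ν-* p p Q) ⟩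
      ν p d + (ν p p + ν p Q)   ≡⟨ cong (λ # → ν p d + #) (cong₂ _+_ (ν-self pp) (∤⇒ν≡0 Q p∤Q)) ⟩
      ν p d + 1                 ≡⟨ +-comm (ν p d) 1 ⟩
      suc (ν p d)               ∎
      where
      open ≡-Reasoning
      instance
        Q≢0 = ∤⇒≢0 Q p∤Q
        pQ≢0 = m*n≢0 p Q

  -- In each case `A` is `d * (p * Q)` with `p ∤ Q`. For odd p the binomial coefficient of p over 2
  -- is a multiple of p, which makes `Q` congruent to x^(p - 1) modulo p. For p = 2 that coefficient
  -- is 1; there 4 ∣ d helps, as `Q` is x + d/2 with d/2 even.
  lifting-prime : ∀ {A} → p ≢ 2 ⊎ 4 ∣ d → (x + d) ^ p ≡ x ^ p + A → ν p A ≡ suc (ν p d)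
  lifting-prime {A} p≢2⊎4∣d eq with p ≟ 2
  lifting-prime {A} (inj₁ p≢2) eq | yes p≡2 = contradiction p≡2 p≢2
  lifting-prime {A} (inj₂ (divides c d≡c*4)) eq | yes refl =
    lifting-cofactor (x + c * 2) p∤Q (+-cancelˡ-≡ (x ^ 2) _ _ (begin
      x ^ 2 + A                     ≡⟨ eq ⟨
      (x + d) ^ 2                   ≡⟨ square x d ⟩
      x ^ 2 + d * (2 * x + d)       ≡⟨ cong (λ # → x ^ 2 + d * (2 * x + #)) d≡c*4 ⟩
      x ^ 2 + d * (2 * x + c * 4)   ≡⟨ cong (λ # → x ^ 2 + d * #) (halve x c) ⟩
      x ^ 2 + d * (2 * (x + c * 2)) ∎))
    where
    open ≡-Reasoning
    p∤Q : 2 ∤ x + c * 2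
    p∤Q p∣Q = p∤x (∣m+n∣m⇒∣n (subst (2 ∣_) (+-comm x _) p∣Q) (n∣m*n c))
    halve : ∀ x c → 2 * x + c * 4 ≡ 2 * (x + c * 2)
    halve = solve-∀
  lifting-prime {A} _ eq | no p≢2 = odd p refl eq
    where
    -- Matching on a copy `q` of `p` exposes `p` as `2 + m`, the exponent in `binomial₃`.
    odd : ∀ q → q ≡ p → (x + d) ^ q ≡ x ^ q + A → ν p A ≡ suc (ν p d)
    odd 0 refl _ = contradiction pp ¬prime[0]
    odd 1 refl _ = contradiction pp ¬prime[1]
    odd (suc (suc m)) refl eq with R , exp ← binomial₃ x d m =
      lifting-cofactor Q p∤Q (+-cancelˡ-≡ (x ^ p) _ _ (begin
        x ^ p + A                                                   ≡⟨ eq ⟨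
        (x + d) ^ p                                                 ≡⟨ exp ⟩
        x ^ p + d * (p * x ^ suc m + d * (tri m * x ^ m + d * R))   ≡⟨ cong₂ (λ #₁ #₂ → x ^ p + d * (p * x ^ suc m + d * (#₁ * x ^ m + #₂ * R)))
                                                                         (m∣n⇒n≡quotient*m p∣tri) (m∣n⇒n≡quotient*m p∣d) ⟩
        x ^ p + d * (p * x ^ suc m + d * (t * p * x ^ m + e * p * R)) ≡⟨ cong (λ # → x ^ p + d * #) (collect p (x ^ suc m) d t (x ^ m) e R) ⟩
        x ^ p + d * (p * Q) ∎))
      where
      open ≡-Reasoning
      -- `2 * tri m` is (p - 1) p, and p is odd.
      p∣tri : p ∣ tri m
      p∣tri with euclidsLemma 2 (tri m) pp (subst (p ∣_) (sym (2*tri m)) (n∣m*n (1 + m)))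
      ... | inj₁ p∣2 = contradiction (prime∣prime⇒≡ pp prime[2] p∣2) p≢2
      ... | inj₂ p∣t = p∣t
      e = quotient p∣d
      t = quotient p∣tri
      Q = x ^ suc m + d * (t * x ^ m + e * R)
      p∤Q : p ∤ Q
      p∤Q p∣Q = p∤x (prime∣^⇒∣ pp x (suc m) (∣m+n∣m⇒∣n (subst (p ∣_) (+-comm (x ^ suc m) _) p∣Q) (∣m⇒∣m*n _ p∣d)))
      collect : ∀ p y d t z e R → p * y + d * (t * p * z + e * p * R) ≡ p * (y + d * (t * z + e * R))
      collect = solve-∀

-- Sums over initial segments

Σ< : ℕ → (ℕ → ℕ) → ℕ
Σ< zero    g = 0
Σ< (suc n) g = g 0 + Σ< n (g ∘ suc)

Σ<-zero : ∀ n → Σ< n (λ _ → 0) ≡ 0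
Σ<-zero zero    = refl
Σ<-zero (suc n) = Σ<-zero n

Σ<-+ : ∀ n f g → Σ< n (λ i → f i + g i) ≡ Σ< n f + Σ< n g
Σ<-+ zero    f g = refl
Σ<-+ (suc n) f g = trans (cong (λ # → f 0 + g 0 + #) (Σ<-+ n (f ∘ suc) (g ∘ suc)))
  (interchange (f 0) (g 0) (Σ< n (f ∘ suc)) (Σ< n (g ∘ suc)))
  where
  interchange : ∀ a b c d → a + b + (c + d) ≡ a + c + (b + d)
  interchange = solve-∀

Σ<-last : ∀ n g → Σ< (suc n) g ≡ Σ< n g + g n
Σ<-last zero    g = +-comm (g 0) 0
Σ<-last (suc n) g = trans (cong (λ # → g 0 + #) (Σ<-last n (g ∘ suc))) (sym (+-assoc (g 0) _ _))

-- Rejected indices contribute zero on the right, which lets the filter disappear. `ι` is arbitrary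
-- so that the induction can compose it with `Fin.suc`.
sum-filter-tabulate : ∀ {A : Set} {P : A → Set} (P? : Decidable P) (f : A → ℕ) {g : ℕ → ℕ} n (ι : Fin n → A) →
  (∀ i → P (ι i) → g (toℕ i) ≡ f (ι i)) → (∀ i → ¬ P (ι i) → g (toℕ i) ≡ 0) →
  sum (map f (filter P? (tabulate ι))) ≡ Σ< n g
sum-filter-tabulate P? f zero    ι accept reject = refl
sum-filter-tabulate P? f (suc n) ι accept reject with P? (ι Fin.zero)
... | yes p = cong₂ _+_ (sym (accept Fin.zero p))
  (sum-filter-tabulate P? f n (ι ∘ Fin.suc) (accept ∘ Fin.suc) (reject ∘ Fin.suc))
... | no ¬p = cong₂ _+_ (sym (reject Fin.zero ¬p))
  (sum-filter-tabulate P? f n (ι ∘ Fin.suc) (accept ∘ Fin.suc) (reject ∘ Fin.suc))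

-- Only the Boolean of the equality test is inspected, so `δ (suc c) x (suc d)` computes to
-- `δ c x d` and `Σ<-δ` is a plain induction.
δ : ℕ → ℕ → ℕ → ℕ
δ c x d = if does (d ≟ c) then x else 0

δ-self : ∀ c x → δ c x c ≡ x
δ-self c x rewrite dec-true (c ≟ c) refl = refl

δ-other : ∀ {c d} x → d ≢ c → δ c x d ≡ 0
δ-other {c} {d} x d≢c rewrite dec-false (d ≟ c) d≢c = refl

Σ<-δ : ∀ {n c} x → c < n → Σ< n (δ c x) ≡ x
Σ<-δ {suc n} {zero}  x _ = trans (cong (λ # → x + #) (Σ<-zero n)) (+-identityʳ x)
Σ<-δ {suc n} {suc c} x (s≤s c<n) = Σ<-δ x c<n

-- Coprimality, least witnesses, residues and powers of p

gcd≡1⇒∤ : ∀ {m n p} → gcd m n ≡ 1 → Prime p → p ∣ m → p ∤ n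
gcd≡1⇒∤ gcd≡1 pp p∣m p∣n =
  ¬prime[1] (subst Prime (∣1⇒≡1 (subst (_ ∣_) gcd≡1 (gcd-greatest p∣m p∣n))) pp)

Least : (ℕ → Set) → ℕ → Set
Least P n = ∃ λ m → m ≤ n × P m × (∀ {v} → v < m → ¬ P v)

least : ∀ {P : ℕ → Set} → Decidable P → ∀ n → P n → Least P n
least {P} P? = <-rec _ λ n rec Pn → search n rec Pn (anyUpTo? P? n)
  where
  search : ∀ n → (∀ {i} → i < n → P i → Least P i) → P n → Dec (∃ λ i → i < n × P i) → Least P n
  search n rec Pn (no ∄) = n , ≤-refl , Pn , λ v<n Pv → ∄ (-, v<n , Pv)
  search n rec Pn (yes (i , i<n , Pi)) with m , m≤i , rest ← rec i<n Pi = m , ≤-trans m≤i (<⇒≤ i<n) , rest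

+-%-≡⇒∣ : ∀ c b p .{{_ : NonZero p}} → c % p ≡ (c + b) % p → p ∣ b
+-%-≡⇒∣ c b p eq = ∣m+n∣m⇒∣n (divides ((c + b) / p) (+-cancelˡ-≡ (c % p) _ _ (begin
  c % p + (c / p * p + b)           ≡⟨ +-assoc (c % p) _ b ⟨
  c % p + c / p * p + b             ≡⟨ cong (_+ b) (m≡m%n+[m/n]*n c p) ⟨
  c + b                             ≡⟨ m≡m%n+[m/n]*n (c + b) p ⟩
  (c + b) % p + (c + b) / p * p     ≡⟨ cong (_+ (c + b) / p * p) eq ⟨
  c % p + (c + b) / p * p           ∎))) (n∣m*n (c / p))
  where open ≡-Reasoning

extract-power : ∀ {p} → Prime p → ∀ n .{{_ : NonZero n}} → ∃₂ λ s m → n ≡ p ^ s * m × p ∤ m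
extract-power {p} pp n = <-rec Extracted step n
  where
  instance
    p-nonTrivial = prime⇒nonTrivial pp
  Extracted : ℕ → Set
  Extracted n = .{{_ : NonZero n}} → ∃₂ λ s m → n ≡ p ^ s * m × p ∤ m
  step : ∀ n → (∀ {m} → m < n → Extracted m) → Extracted n
  step n rec with p ∣? n
  ... | no p∤n = 0 , n , sym (+-identityʳ n) , p∤n
  ... | yes p∣n with s , m , q≡ , p∤m ← rec (quotient-< p∣n) {{quotient≢0 p∣n}} =
    suc s , m , trans (m∣n⇒n≡m*quotient p∣n) (trans (cong (p *_) q≡) (sym (*-assoc p (p ^ s) m))) , p∤m

-- Divisor sums and Möbius inversion along a chain

-- The summand at `n` stands apart to match the recursion of `Φ`: Φ_n times the product over the
-- proper divisors is k^n - h^n, and taking exponents turns that product into this sum.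
divisorSum : (ℕ → ℕ) → ℕ → ℕ
divisorSum f n = sum (map (f ∘ toℕ) (properDivisors n)) + f n

divisorSum≡Σ< : ∀ f n {g} → (∀ {d} → d ∣ n → g d ≡ f d) → (∀ {d} → d ∤ n → g d ≡ 0) →
                divisorSum f n ≡ Σ< (suc n) g
divisorSum≡Σ< f n {g} accept reject = begin
  sum (map (f ∘ toℕ) (properDivisors n)) + f n
    ≡⟨ cong₂ _+_ (sum-filter-tabulate (λ d → toℕ d ∣? n) (f ∘ toℕ) n id (λ _ → accept) (λ _ → reject)) (sym (accept ∣-refl)) ⟩
  Σ< n g + g n
    ≡⟨ Σ<-last n g ⟨
  Σ< (suc n) g ∎
  where open ≡-Reasoning

^-monoʳ-∣ : ∀ p {i j} → i ≤ j → p ^ i ∣ p ^ j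
^-monoʳ-∣ p {i} {j} i≤j = divides (p ^ (j ∸ i)) (trans (cong (p ^_) (sym (m∸n+n≡m i≤j))) (^-distribˡ-+-* p (j ∸ i) i))

-- Möbius inversion along u, p u, p² u, …: the function step is supported there,
-- and its sum over the divisors of p^s u telescopes to F (p^s u).
module Staircase (p u : ℕ) (1<p : 1 < p) .{{_ : NonZero u}}
  (F : ℕ → ℕ) (F-mono : ∀ i → F (p ^ i * u) ≤ F (p ^ suc i * u)) where

  rung : ℕ → ℕ
  rung i = p ^ i * u

  rung-mono : ∀ {i j} → i < j → rung i < rung j
  rung-mono i<j = *-monoˡ-< u (^-monoʳ-< p 1<p i<j)

  <rung : ∀ i → i < rung i
  <rung i = <-≤-trans (n<p^n 1<p i) (m≤m*n (p ^ i) u)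

  increment : ℕ → ℕ
  increment zero    = F (rung 0)
  increment (suc i) = F (rung (suc i)) ∸ F (rung i)

  -- The truncation of `step` to the rungs 0, ..., s.
  partial : ℕ → ℕ → ℕ
  partial zero    d = δ (rung 0) (increment 0) d
  partial (suc s) d = partial s d + δ (rung (suc s)) (increment (suc s)) d

  partial-miss : ∀ s {d} → (∀ {i} → i ≤ s → d ≢ rung i) → partial s d ≡ 0
  partial-miss zero    miss = δ-other _ (miss z≤n)
  partial-miss (suc s) miss = cong₂ _+_ (partial-miss s (miss ∘ m≤n⇒m≤1+n)) (δ-other _ (miss ≤-refl))

  partial-rung : ∀ s {i} → i ≤ s → partial s (rung i) ≡ increment i
  partial-rung zero    z≤n = δ-self (rung 0) _
  partial-rung (suc s) i≤1+s with m≤n⇒m<n∨m≡n i≤1+s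
  ... | inj₁ (s≤s i≤s) = trans (cong₂ _+_ (partial-rung s i≤s) (δ-other _ (<⇒≢ (rung-mono (s≤s i≤s))))) (+-identityʳ _)
  ... | inj₂ refl      = cong₂ _+_ (partial-miss s λ i≤s → ≢-sym (<⇒≢ (rung-mono (s≤s i≤s)))) (δ-self (rung (suc s)) _)

  Σ<-partial : ∀ s {n} → rung s < n → Σ< n (partial s) ≡ F (rung s)
  Σ<-partial zero    <n = Σ<-δ _ <n
  Σ<-partial (suc s) {n} <n = begin
    Σ< n (partial (suc s))                                           ≡⟨ Σ<-+ n (partial s) _ ⟩
    Σ< n (partial s) + Σ< n (δ (rung (suc s)) (increment (suc s)))   ≡⟨ cong₂ _+_ (Σ<-partial s (<-trans (rung-mono (n<1+n s)) <n)) (Σ<-δ _ <n) ⟩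
    F (rung s) + (F (rung (suc s)) ∸ F (rung s))                     ≡⟨ m+[n∸m]≡n (F-mono s) ⟩
    F (rung (suc s))                                                 ∎
    where open ≡-Reasoning

  -- Since `i < rung i`, every rung that can equal `d` has a number below `d`, so truncating at `d`
  -- loses nothing.
  step : ℕ → ℕ
  step d = partial d d

  step-rung : ∀ i → step (rung i) ≡ increment i
  step-rung i = partial-rung (rung i) (<⇒≤ (<rung i))

  step-miss : ∀ {d} → (∀ i → d ≢ rung i) → step d ≡ 0
  step-miss {d} miss = partial-miss d λ {i} _ → miss i

  rung? : ∀ d → (∃ λ i → d ≡ rung i) ⊎ (∀ i → d ≢ rung i)
  rung? d with anyUpTo? (λ i → d ≟ rung i) d
  ... | yes (i , _ , d≡) = inj₁ (i , d≡)
  ... | no ∄             = inj₂ λ i d≡ → ∄ (i , subst (i <_) (sym d≡) (<rung i) , d≡)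

  -- On divisors of n, `step` agrees with `partial s`, because only rungs up to s divide n. Off the
  -- divisors `partial s` vanishes, because each of its rungs divides `rung s` and hence n.
  divisorSum-step : ∀ n .{{_ : NonZero n}} s → (∀ i → rung i ∣ n → i ≤ s) → rung s ∣ n →
                    divisorSum step n ≡ F (rung s)
  divisorSum-step n s ∣n⇒≤s rs∣n = trans (divisorSum≡Σ< step n accept reject) (Σ<-partial s (s≤s (∣⇒≤ rs∣n)))
    where
    accept : ∀ {d} → d ∣ n → partial s d ≡ step d
    accept {d} d∣n with rung? d
    ... | inj₂ miss       = trans (partial-miss s λ {i} _ → miss i) (sym (step-miss miss))
    ... | inj₁ (i , refl) = trans (partial-rung s (∣n⇒≤s i d∣n)) (sym (step-rung i))
    reject : ∀ {d} → d ∤ n → partial s d ≡ 0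
    reject d∤n = partial-miss s λ { {i} i≤s refl → d∤n (∣-trans (*-monoˡ-∣ u (^-monoʳ-∣ p i≤s)) rs∣n) }

  divisorSum-step-∤ : ∀ n → u ∤ n → divisorSum step n ≡ 0
  divisorSum-step-∤ n u∤n = trans (divisorSum≡Σ< step n accept (λ _ → refl)) (Σ<-zero (suc n))
    where
    accept : ∀ {d} → d ∣ n → 0 ≡ step d
    accept {d} d∣n = sym (step-miss {d} λ { i refl → u∤n (∣-trans (n∣m*n (p ^ i)) d∣n) })

-- Integers inside the rationals, and lists of proper divisors

-- A product of fractions with denominator 1 unfolds to the normalised quotient of `x ℤ.* y` by 1,
-- which is numerator over denominator of the right-hand side.
fromℤ-* : ∀ x y → fromℤ x ℚ.* fromℤ y ≡ fromℤ (x ℤ.* y)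
fromℤ-* x y = ℚ.↥p/↧p≡p (fromℤ (x ℤ.* y))

fromℤ-*-÷₀ : ∀ x y → y ≢ 0ℤ → fromℤ (x ℤ.* y) ÷₀ fromℤ y ≡ fromℤ x
fromℤ-*-÷₀ x y y≢0 with fromℤ y ℚ.≟ 0ℚ
... | yes y≡0 = contradiction (cong ↥_ y≡0) y≢0
... | no  ≢0  = begin
  fromℤ (x ℤ.* y) ℚ.* ℚ.1/ fromℤ y         ≡⟨ cong (ℚ._* ℚ.1/ fromℤ y) (fromℤ-* x y) ⟨
  fromℤ x ℚ.* fromℤ y ℚ.* ℚ.1/ fromℤ y     ≡⟨ ℚ.*-assoc (fromℤ x) (fromℤ y) _ ⟩
  fromℤ x ℚ.* (fromℤ y ℚ.* ℚ.1/ fromℤ y)   ≡⟨ cong (fromℤ x ℚ.*_) (ℚ.*-inverseʳ (fromℤ y)) ⟩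
  fromℤ x ℚ.* 1ℚ                           ≡⟨ ℚ.*-identityʳ (fromℤ x) ⟩
  fromℤ x                                  ∎
  where
  open ≡-Reasoning
  instance
    _ = ℚ.≢-nonZero ≢0

productℚ-fromℤ : ∀ {A : Set} {f : A → ℚ} {g : A → ℕ} {xs} → All (λ x → f x ≡ fromℤ (+ g x)) xs →
                 productℚ (map f xs) ≡ fromℤ (+ product (map g xs))
productℚ-fromℤ [] = refl
productℚ-fromℤ {g = g} {x ∷ xs} (eq ∷ eqs) = trans (cong₂ ℚ._*_ eq (productℚ-fromℤ eqs))
  (trans (fromℤ-* (+ g x) _) (cong fromℤ (sym (ℤ.pos-* (g x) _))))

-- The divisor 1 is split off because Φ_1 = k - h is the only value that can be negative.
largeDivisors : ∀ m → List (Fin (2+ m))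
largeDivisors m = filter (λ d → toℕ d ∣? 2+ m) (tabulate (Fin.suc ∘ Fin.suc))

properDivisors-2+ : ∀ m → properDivisors (2+ m) ≡ Fin.suc Fin.zero ∷ largeDivisors m
properDivisors-2+ m = trans
  (filter-reject (λ d → toℕ d ∣? 2+ m) {xs = tabulate Fin.suc} λ 0∣ → contradiction (0∣⇒≡0 0∣) λ ())
  (filter-accept (λ d → toℕ d ∣? 2+ m) {xs = tabulate (Fin.suc ∘ Fin.suc)} (1∣ (2+ m)))

properDivisors-nonZero : ∀ n .{{_ : NonZero n}} → All (NonZero ∘ toℕ) (properDivisors n)
properDivisors-nonZero n = All.map
  (λ d∣n → ≢-nonZero λ d≡0 → ≢-nonZero⁻¹ n (0∣⇒≡0 (subst (_∣ n) d≡0 d∣n)))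
  (all-filter (λ d → toℕ d ∣? n) (allFin n))

largeDivisors-≢1 : ∀ m → All (λ d → toℕ d ≢ 1) (largeDivisors m)
largeDivisors-≢1 m = filter⁺ (λ d → toℕ d ∣? 2+ m) (tabulate⁺ {f = Fin.suc ∘ Fin.suc} λ _ ())

-- The sequence |k^n - h^n| and primitive indices

-- lo and hi are k and h in increasing order, and ε is the sign of k − h.
module Zsigmondy (k h lo hi : ℕ) (lo<hi : lo < hi) (gcd≡1 : gcd lo hi ≡ 1)
  (ε : ℤ) (∣ε∣≡1 : ∣ ε ∣ ≡ 1) (term≡ε* : ∀ n → term n k h ≡ ε ℤ.* + (hi ^ n ∸ lo ^ n))
  where

  a : ℕ → ℕ
  a n = ∣ term n k h ∣

  a≡ : ∀ n → a n ≡ hi ^ n ∸ lo ^ n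
  a≡ n = begin
    ∣ term n k h ∣                  ≡⟨ cong ∣_∣ (term≡ε* n) ⟩
    ∣ ε ℤ.* + (hi ^ n ∸ lo ^ n) ∣   ≡⟨ ℤ.abs-* ε _ ⟩
    ∣ ε ∣ * (hi ^ n ∸ lo ^ n)       ≡⟨ cong (_* (hi ^ n ∸ lo ^ n)) ∣ε∣≡1 ⟩
    1 * (hi ^ n ∸ lo ^ n)           ≡⟨ *-identityˡ _ ⟩
    hi ^ n ∸ lo ^ n                 ∎
    where open ≡-Reasoning

  term≡ : ∀ n → term n k h ≡ ε ℤ.* + a n
  term≡ n = trans (term≡ε* n) (cong (λ # → ε ℤ.* + #) (sym (a≡ n)))

  hi^n≡ : ∀ n → hi ^ n ≡ lo ^ n + a n
  hi^n≡ n = sym (trans (cong (λ # → lo ^ n + #) (a≡ n)) (m+[n∸m]≡n (^-monoˡ-≤ n (<⇒≤ lo<hi))))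

  a≢0 : ∀ n .{{_ : NonZero n}} → NonZero (a n)
  a≢0 n = subst NonZero (sym (a≡ n)) (>-nonZero (m<n⇒0<n∸m (^-monoˡ-< n lo<hi)))

  -- This identity yields both divisibility at multiples (`∣a-*`) and the passage to remainders
  -- (`index∣`).
  a-+ : ∀ m n → a (m + n) ≡ hi ^ m * a n + lo ^ n * a m
  a-+ m n = +-cancelˡ-≡ (lo ^ (m + n)) _ _ (begin
    lo ^ (m + n) + a (m + n)                            ≡⟨ hi^n≡ (m + n) ⟨
    hi ^ (m + n)                                        ≡⟨ ^-distribˡ-+-* hi m n ⟩
    hi ^ m * hi ^ n                                     ≡⟨ cong (hi ^ m *_) (hi^n≡ n) ⟩
    hi ^ m * (lo ^ n + a n)                             ≡⟨ *-distribˡ-+ (hi ^ m) _ _ ⟩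
    hi ^ m * lo ^ n + hi ^ m * a n                      ≡⟨ cong (λ # → # * lo ^ n + hi ^ m * a n) (hi^n≡ m) ⟩
    (lo ^ m + a m) * lo ^ n + hi ^ m * a n              ≡⟨ lemma (lo ^ m) (a m) (lo ^ n) (hi ^ m * a n) ⟩
    lo ^ m * lo ^ n + (hi ^ m * a n + lo ^ n * a m)     ≡⟨ cong (_+ (hi ^ m * a n + lo ^ n * a m)) (^-distribˡ-+-* lo m n) ⟨
    lo ^ (m + n) + (hi ^ m * a n + lo ^ n * a m)        ∎)
    where
    open ≡-Reasoning
    lemma : ∀ x y z w → (x + y) * z + w ≡ x * z + (w + z * y)
    lemma = solve-∀

  -- Shaped as the equation the lifting lemmas expect, with `lo ^ u` for `x` and `a u` for `d`.
  a-* : ∀ u m → (lo ^ u + a u) ^ m ≡ (lo ^ u) ^ m + a (u * m)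
  a-* u m = begin
    (lo ^ u + a u) ^ m         ≡⟨ cong (_^ m) (hi^n≡ u) ⟨
    (hi ^ u) ^ m               ≡⟨ ^-*-assoc hi u m ⟩
    hi ^ (u * m)               ≡⟨ hi^n≡ (u * m) ⟩
    lo ^ (u * m) + a (u * m)   ≡⟨ cong (_+ a (u * m)) (^-*-assoc lo u m) ⟨
    (lo ^ u) ^ m + a (u * m)   ∎
    where open ≡-Reasoning

  ∣a-* : ∀ {c u} → c ∣ a u → ∀ m → c ∣ a (m * u)
  ∣a-* {c} c∣a zero    = c ∣0
  ∣a-* {c} {u} c∣a (suc m) = subst (c ∣_) (sym (a-+ u (m * u)))
    (∣m∣n⇒∣m+n (∣n⇒∣m*n (hi ^ u) (∣a-* c∣a m)) (∣n⇒∣m*n (lo ^ (m * u)) c∣a))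

  module _ {p} (pp : Prime p) where

    private
      instance
        p≢0 = prime⇒nonZero pp

    ∣a⇒∤lo : ∀ {n} → 0 < n → p ∣ a n → p ∤ lo
    ∣a⇒∤lo {suc n} _ p∣a p∣lo = gcd≡1⇒∤ gcd≡1 pp p∣lo (prime∣^⇒∣ pp hi (suc n)
      (subst (p ∣_) (sym (hi^n≡ (suc n))) (∣m∣n⇒∣m+n (∣m⇒∣m*n (lo ^ n) p∣lo) p∣a)))

    ∣a⇒∤hi : ∀ {n} → 0 < n → p ∣ a n → p ∤ hi
    ∣a⇒∤hi {suc n} 0<n p∣a p∣hi = ∣a⇒∤lo 0<n p∣a (prime∣^⇒∣ pp lo (suc n)
      (∣m+n∣m⇒∣n (subst (p ∣_) (trans (hi^n≡ (suc n)) (+-comm (lo ^ suc n) _)) (∣m⇒∣m*n (hi ^ n) p∣hi)) p∣a))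

    -- Write n = q u + r with r < u. By `a-+`, p divides `hi ^ (q * u) * a r`; as p ∤ hi, it divides
    -- `a r`, and minimality of u forces r = 0.
    index∣ : ∀ {u n} → IsPrimitiveIndex p k h u → p ∣ a n → u ∣ n
    index∣ {u} {n} (0<u , p∣au , min) p∣an = m%n≡0⇒n∣m n u (n≤0⇒n≡0 (≮⇒≥ λ 0<r → min (m%n<n n u) 0<r p∣ar))
      where
      instance
        u≢0 = >-nonZero 0<u
      p∣ : p ∣ hi ^ (n / u * u) * a (n % u)
      p∣ = ∣m+n∣m⇒∣n (subst (p ∣_) (begin
          a n                     ≡⟨ cong a (trans (m≡m%n+[m/n]*n n u) (+-comm (n % u) _)) ⟩
          a (n / u * u + n % u)   ≡⟨ a-+ (n / u * u) (n % u) ⟩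
          hi ^ (n / u * u) * a (n % u) + lo ^ (n % u) * a (n / u * u) ≡⟨ +-comm (hi ^ (n / u * u) * a (n % u)) _ ⟩
          lo ^ (n % u) * a (n / u * u) + hi ^ (n / u * u) * a (n % u) ∎) p∣an)
        (∣n⇒∣m*n (lo ^ (n % u)) (∣a-* p∣au (n / u)))
        where open ≡-Reasoning
      p∣ar : p ∣ a (n % u)
      p∣ar = [ (λ p∣hi^ → contradiction (prime∣^⇒∣ pp hi (n / u * u) p∣hi^) (∣a⇒∤hi 0<u p∣au)) , id ]′
        (euclidsLemma (hi ^ (n / u * u)) (a (n % u)) pp p∣)

    index-unique : ∀ {u u′} → IsPrimitiveIndex p k h u → IsPrimitiveIndex p k h u′ → u ≡ u′
    index-unique i@(_ , p∣au , _) i′@(_ , p∣au′ , _) = ∣-antisym (index∣ i p∣au′) (index∣ i′ p∣au)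

    -- Two of the p nonzero residues of hi^i lo^(p−1−i), 0 ≤ i < p, agree.
    small-exponent : p ∤ lo → p ∤ hi → ∃ λ e → 0 < e × e < p × p ∣ a e
    small-exponent p∤lo p∤hi = collision (pigeonhole (n<1+n q) residue)
      where
      q = pred p
      g : ℕ → ℕ
      g i = hi ^ i * lo ^ (q ∸ i)
      p∤hi^ : ∀ i → p ∤ hi ^ i
      p∤hi^ i = p∤hi ∘ prime∣^⇒∣ pp hi i
      p∤lo^ : ∀ i → p ∤ lo ^ i
      p∤lo^ i = p∤lo ∘ prime∣^⇒∣ pp lo i
      residue≢0 : ∀ i → NonZero (g i % p)
      residue≢0 i = ≢-nonZero λ gi%p≡0 →
        [ p∤hi^ i , p∤lo^ (q ∸ i) ]′ (euclidsLemma (hi ^ i) _ pp (m%n≡0⇒n∣m (g i) p gi%p≡0))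
      bound : ∀ i → pred (g i % p) < q
      bound i = pred-mono-< {{residue≢0 i}} (m%n<n (g i) p)
      -- Nonzero residues are lowered by one, so that p indices fall into p - 1 boxes.
      residue : Fin (suc q) → Fin q
      residue i = fromℕ< (bound (toℕ i))
      collision : (∃₂ λ i j → toℕ i < toℕ j × residue i ≡ residue j) → ∃ λ e → 0 < e × e < p × p ∣ a e
      collision (i , j , i<j , ri≡rj) = e , m<n⇒0<n∸m i<j , ≤-<-trans (m∸n≤m (toℕ j) (toℕ i)) j<p , p∣ae
        where
        open ≡-Reasoning
        e = toℕ j ∸ toℕ i
        -- `g` is `b * lo ^ e` at `i` and `b * hi ^ e` at `j`, so the two values differ by
        -- `b * a e`, where p ∤ b.
        b = hi ^ toℕ i * lo ^ (q ∸ toℕ j)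
        j<p : toℕ j < p
        j<p = subst (toℕ j <_) (suc-pred p) (toℕ<n j)
        j≡ : toℕ j ≡ toℕ i + e
        j≡ = sym (m+[n∸m]≡n (<⇒≤ i<j))
        q∸i≡ : q ∸ toℕ i ≡ q ∸ toℕ j + e
        q∸i≡ = begin
          q ∸ toℕ i             ≡⟨ m∸n+n≡m (m+n≤o⇒m≤o∸n e (subst (_≤ q) (trans j≡ (+-comm (toℕ i) e)) (≤-pred (toℕ<n j)))) ⟨
          q ∸ toℕ i ∸ e + e     ≡⟨ cong (_+ e) (∸-+-assoc q (toℕ i) e) ⟩
          q ∸ (toℕ i + e) + e   ≡⟨ cong (λ # → q ∸ # + e) j≡ ⟨
          q ∸ toℕ j + e         ∎
        gi≡ : g (toℕ i) ≡ b * lo ^ e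
        gi≡ = begin
          hi ^ toℕ i * lo ^ (q ∸ toℕ i)              ≡⟨ cong (λ # → hi ^ toℕ i * lo ^ #) q∸i≡ ⟩
          hi ^ toℕ i * lo ^ (q ∸ toℕ j + e)          ≡⟨ cong (hi ^ toℕ i *_) (^-distribˡ-+-* lo (q ∸ toℕ j) e) ⟩
          hi ^ toℕ i * (lo ^ (q ∸ toℕ j) * lo ^ e)   ≡⟨ *-assoc (hi ^ toℕ i) _ _ ⟨
          b * lo ^ e                                 ∎
        gj≡ : g (toℕ j) ≡ g (toℕ i) + b * a e
        gj≡ = begin
          hi ^ toℕ j * lo ^ (q ∸ toℕ j)                ≡⟨ cong (λ # → hi ^ # * lo ^ (q ∸ toℕ j)) j≡ ⟩
          hi ^ (toℕ i + e) * lo ^ (q ∸ toℕ j)          ≡⟨ cong (_* lo ^ (q ∸ toℕ j)) (^-distribˡ-+-* hi (toℕ i) e) ⟩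
          hi ^ toℕ i * hi ^ e * lo ^ (q ∸ toℕ j)       ≡⟨ *-assoc (hi ^ toℕ i) _ _ ⟩
          hi ^ toℕ i * (hi ^ e * lo ^ (q ∸ toℕ j))     ≡⟨ cong (hi ^ toℕ i *_) (*-comm (hi ^ e) _) ⟩
          hi ^ toℕ i * (lo ^ (q ∸ toℕ j) * hi ^ e)     ≡⟨ *-assoc (hi ^ toℕ i) _ _ ⟨
          b * hi ^ e                                   ≡⟨ cong (b *_) (hi^n≡ e) ⟩
          b * (lo ^ e + a e)                           ≡⟨ *-distribˡ-+ b _ _ ⟩
          b * lo ^ e + b * a e                         ≡⟨ cong (_+ b * a e) gi≡ ⟨
          g (toℕ i) + b * a e                          ∎
        pred≡ : pred (g (toℕ i) % p) ≡ pred (g (toℕ j) % p)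
        pred≡ = fromℕ<-injective _ _ _ _ ri≡rj
        %≡ : g (toℕ i) % p ≡ g (toℕ j) % p
        %≡ = pred-injective {{residue≢0 (toℕ i)}} {{residue≢0 (toℕ j)}} pred≡
        p∣b*ae : p ∣ b * a e
        p∣b*ae = +-%-≡⇒∣ (g (toℕ i)) (b * a e) p (trans %≡ (cong (_% p) gj≡))
        p∣ae : p ∣ a e
        p∣ae with euclidsLemma b (a e) pp p∣b*ae
        ... | inj₂ p∣ae = p∣ae
        ... | inj₁ p∣b  = contradiction (euclidsLemma (hi ^ toℕ i) _ pp p∣b) [ p∤hi^ (toℕ i) , p∤lo^ (q ∸ toℕ j) ]′

    least⇒index : ∀ {e} → Least (λ v → 0 < v × p ∣ a v) e → ∃ λ u → u ≤ e × IsPrimitiveIndex p k h u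
    least⇒index (u , u≤e , (0<u , p∣au) , min) = u , u≤e , 0<u , p∣au , λ v<u 0<v p∣av → min v<u (0<v , p∣av)

    index-exists : p ∤ lo → p ∤ hi → ∃ λ u → u < p × IsPrimitiveIndex p k h u
    index-exists p∤lo p∤hi =
      let e , 0<e , e<p , p∣ae = small-exponent p∤lo p∤hi
          u , u≤e , index = least⇒index (least (λ v → (0 <? v) ×-dec (p ∣? a v)) e (0<e , p∣ae))
      in u , ≤-<-trans u≤e e<p , index

    -- The pigeonhole argument produces an index below p; by uniqueness it is the given one.
    index< : ∀ {u} → IsPrimitiveIndex p k h u → u < p
    index< i@(0<u , p∣au , _) =
      let u′ , u′<p , i′ = index-exists (∣a⇒∤lo 0<u p∣au) (∣a⇒∤hi 0<u p∣au)
      in subst (_< p) (index-unique i′ i) u′<p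

  -- The exponent of a prime in Φ_n(k,h), computed from lifting

  -- Candidate exponents of p in the Φ_n, available before any Φ_n is known to be an integer. By
  -- Möbius inversion `sums` determines them at every n > 0; the other fields evaluate them.
  record ExponentSequence (p : ℕ) : Set where
    field
      exponent    : ℕ → ℕ
      sums        : ∀ n .{{_ : NonZero n}} → divisorSum exponent n ≡ ν p (a n)
      at-index    : ∀ {u} → IsPrimitiveIndex p k h u → exponent u ≡ ν p (a u)
      at-multiple : ∀ z {u} → 0 < z → IsPrimitiveIndex p k h u → p ^ z * u ≢ 2 → exponent (p ^ z * u) ≡ 1
      elsewhere   : ∀ n → ¬ IsPrimitiveIndex p k h n →
                    (∀ z u → 0 < z → IsPrimitiveIndex p k h u → n ≢ p ^ z * u) → exponent n ≡ 0

  -- `a (v * 2)` is `a v` times `2 * lo ^ v + a v`, and both factors are even.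
  four∣a : ∀ v → 2 ∣ a v → 4 ∣ a (v * 2)
  four∣a v 2∣av = subst (4 ∣_) (+-cancelˡ-≡ ((lo ^ v) ^ 2) _ _ (trans (sym (square (lo ^ v) (a v))) (a-* v 2)))
    (*-pres-∣ 2∣av (∣m∣n⇒∣m+n (m∣m*n (lo ^ v)) 2∣av))

  module _ {p u} (pp : Prime p) (index : IsPrimitiveIndex p k h u) where

    private
      instance
        p≢0 = prime⇒nonZero pp
        p-nonTrivial = prime⇒nonTrivial pp
        u≢0 = >-nonZero (proj₁ index)

      F : ℕ → ℕ
      F n = ν p (a n)

      p∤lo^ : ∀ w → p ∤ lo ^ w
      p∤lo^ w = ∣a⇒∤lo pp (proj₁ index) (proj₁ (proj₂ index)) ∘ prime∣^⇒∣ pp lo w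

    F-mono : ∀ i → F (p ^ i * u) ≤ F (p ^ suc i * u)
    F-mono i = ν-mono-∣ p {{a≢0 _ {{m*n≢0 (p ^ suc i) u {{m^n≢0 p (suc i)}}}}}}
      (subst (λ # → a (p ^ i * u) ∣ a #) (sym (*-assoc p (p ^ i) u)) (∣a-* ∣-refl p))

    open Staircase p u (nonTrivial⇒n>1 p) F F-mono

    p∣a-rung : ∀ i → p ∣ a (rung i)
    p∣a-rung i = ∣a-* (proj₁ (proj₂ index)) (p ^ i)

    a-rung≢0 : ∀ i → NonZero (a (rung i))
    a-rung≢0 i = a≢0 (rung i) {{m*n≢0 (p ^ i) u {{m^n≢0 p i}}}}

    F-cofactor : ∀ i m → p ∤ m → F (rung i * m) ≡ F (rung i)
    F-cofactor i m p∤m = lifting-coprime pp (p∤lo^ (rung i)) (p∣a-rung i) {{a-rung≢0 i}} m p∤m (a-* (rung i) m)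

    rung-suc : ∀ i → rung (suc i) ≡ rung i * p
    rung-suc i = trans (*-assoc p (p ^ i) u) (*-comm p (rung i))

    -- For p = 2 the index is below 2, hence 1, and then `rung 1` is the excluded 2. From the next
    -- rung on, the rung is twice an earlier one, so `four∣a` applies.
    odd∨four∣ : ∀ i → rung (suc i) ≢ 2 → p ≢ 2 ⊎ 4 ∣ a (rung i)
    odd∨four∣ i r≢2 with p ≟ 2
    ... | no p≢2 = inj₁ p≢2
    odd∨four∣ zero r≢2 | yes refl =
      contradiction (cong (2 *_) (≤-antisym (≤-pred (index< pp index)) (proj₁ index))) r≢2
    odd∨four∣ (suc i) r≢2 | yes refl =
      inj₂ (subst (λ # → 4 ∣ a #) (sym (rung-suc i)) (four∣a (rung i) (p∣a-rung i)))

    F-rung-suc : ∀ i → rung (suc i) ≢ 2 → F (rung (suc i)) ≡ suc (F (rung i))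
    F-rung-suc i r≢2 = trans (cong F (rung-suc i))
      (lifting-prime pp (p∤lo^ (rung i)) (p∣a-rung i) {{a-rung≢0 i}} (odd∨four∣ i r≢2) (a-* (rung i) p))

    -- If u ∤ n, then p ∤ a n and both sides vanish. Otherwise n is `rung s * m` with p ∤ m: the sum
    -- telescopes to `F (rung s)`, and the cofactor m leaves the exponent unchanged.
    step-sums : ∀ n .{{_ : NonZero n}} → divisorSum step n ≡ F n
    step-sums n with u ∣? n
    ... | no u∤n = trans (divisorSum-step-∤ n u∤n) (sym (∤⇒ν≡0 (a n) (u∤n ∘ index∣ pp index)))
    ... | yes u∣n with s , m , q≡ , p∤m ← extract-power pp (quotient u∣n) {{quotient≢0 u∣n}} =
      trans (divisorSum-step n s ∣n⇒≤s (subst (rung s ∣_) (sym n≡) (m∣m*n m)))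
            (trans (sym (F-cofactor s m p∤m)) (cong F (sym n≡)))
      where
      n≡p^s*m*u : n ≡ p ^ s * m * u
      n≡p^s*m*u = trans (m∣n⇒n≡quotient*m u∣n) (cong (_* u) q≡)
      n≡ : n ≡ rung s * m
      n≡ = trans n≡p^s*m*u (swap (p ^ s) m u)
        where
        swap : ∀ x y z → x * y * z ≡ x * z * y
        swap = solve-∀
      -- A higher rung dividing n would, after cancelling u and p^s, put a factor p into m.
      ∣n⇒≤s : ∀ i → rung i ∣ n → i ≤ s
      ∣n⇒≤s i ri∣n = ≮⇒≥ λ s<i → p∤m (*-cancelˡ-∣ (p ^ s) {{m^n≢0 p s}} (begin
        p ^ s * p   ≡⟨ *-comm (p ^ s) p ⟩
        p ^ suc s   ∣⟨ ^-monoʳ-∣ p s<i ⟩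
        p ^ i       ∣⟨ *-cancelʳ-∣ u (subst (rung i ∣_) n≡p^s*m*u ri∣n) ⟩
        p ^ s * m   ∎))
        where open ∣-Reasoning

    stairs : ExponentSequence p
    stairs = record
      { exponent    = step
      ; sums        = step-sums
      ; at-index    = λ i → subst (λ u′ → step u′ ≡ F u′) (index-unique pp index i) step-u
      ; at-multiple = λ z 0<z i r≢2 → at-multiple z 0<z (index-unique pp index i) r≢2
      ; elsewhere   = λ n ¬i ¬m → step-miss {n} (λ where
          zero    refl → ¬i (subst (IsPrimitiveIndex p k h) (sym (*-identityˡ u)) index)
          (suc z) refl → ¬m (suc z) u (s≤s z≤n) index refl)
      }
      where
      step-u : step u ≡ F u
      step-u = subst (λ u′ → step u′ ≡ F u′) (*-identityˡ u) (step-rung 0)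
      at-multiple : ∀ z {u′} → 0 < z → u ≡ u′ → p ^ z * u′ ≢ 2 → step (p ^ z * u′) ≡ 1
      at-multiple (suc i) _ refl r≢2 = begin
        step (rung (suc i))              ≡⟨ step-rung (suc i) ⟩
        F (rung (suc i)) ∸ F (rung i)    ≡⟨ cong (_∸ F (rung i)) (F-rung-suc i r≢2) ⟩
        suc (F (rung i)) ∸ F (rung i)    ≡⟨ m+n∸n≡m 1 (F (rung i)) ⟩
        1                                ∎
        where open ≡-Reasoning

  no-exponents : ∀ {p} → (∀ {n} → 0 < n → p ∤ a n) → ExponentSequence p
  no-exponents p∤a = record
    { exponent    = λ _ → 0
    ; sums        = λ n → trans (divisorSum≡Σ< (λ _ → 0) n (λ _ → refl) (λ _ → refl))
                                (trans (Σ<-zero (suc n)) (sym (∤⇒ν≡0 (a n) (p∤a (>-nonZero⁻¹ n)))))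
    ; at-index    = λ (0<u , p∣au , _) → contradiction p∣au (p∤a 0<u)
    ; at-multiple = λ _ _ (0<u , p∣au , _) → contradiction p∣au (p∤a 0<u)
    ; elsewhere   = λ _ _ _ → refl
    }

  -- By coprimality a prime dividing `lo` or `hi` divides no `a n` with n > 0, and the zero sequence
  -- serves; every other prime has an index.
  exponents : ∀ {p} → Prime p → ExponentSequence p
  exponents {p} pp with p ∣? lo | p ∣? hi
  ... | yes p∣lo | _        = no-exponents λ 0<n p∣a → ∣a⇒∤lo pp 0<n p∣a p∣lo
  ... | _        | yes p∣hi = no-exponents λ 0<n p∣a → ∣a⇒∤hi pp 0<n p∣a p∣hi
  ... | no p∤lo  | no p∤hi  = stairs pp (proj₂ (proj₂ (index-exists pp p∤lo p∤hi)))

  -- Integrality, sign and factorisation of Φ_n(k,h)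

  Φ₁≡ : Φ 1 k h ≡ fromℤ (term 1 k h)
  Φ₁≡ = begin
    Φ 1 k h                                     ≡⟨ Φ-unfold 1 k h ⟩
    fromℤ (term 1 k h) ÷₀ 1ℚ                    ≡⟨ cong (λ t → fromℤ t ÷₀ 1ℚ) (ℤ.*-identityʳ (term 1 k h)) ⟨
    fromℤ (term 1 k h ℤ.* ℤ.1ℤ) ÷₀ fromℤ ℤ.1ℤ   ≡⟨ fromℤ-*-÷₀ (term 1 k h) ℤ.1ℤ (λ ()) ⟩
    fromℤ (term 1 k h)                          ∎
    where open ≡-Reasoning

  -- Becomes |Φ_n(k,h)| once the value is known to be an integer; taking the numerator gives a
  -- natural number beforehand.
  φ : ℕ → ℕ
  φ n = ∣ ↥ Φ n k h ∣

  φ₁≡a₁ : φ 1 ≡ a 1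
  φ₁≡a₁ = cong (∣_∣ ∘ ↥_) Φ₁≡

  -- `positive` asserts integrality as well as the sign. It leaves out n = 1, where the value k - h
  -- may be negative.
  record Cyclotomic (n : ℕ) : Set where
    field
      value≢0   : NonZero (φ n)
      positive  : n ≢ 1 → Φ n k h ≡ fromℤ (+ φ n)
      valuation : ∀ {p} (pp : Prime p) → ν p (φ n) ≡ ExponentSequence.exponent (exponents pp) n

  cyclotomic-1 : Cyclotomic 1
  cyclotomic-1 = record
    { value≢0   = subst NonZero (sym φ₁≡a₁) (a≢0 1)
    ; positive  = λ 1≢1 → contradiction refl 1≢1
    ; valuation = λ {p} pp → trans (cong (ν p) φ₁≡a₁) (sym (ExponentSequence.sums (exponents pp) 1))
    }

  -- By induction the exponent of p in `D`, the product of the earlier |Φ_d|, is the sum of the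
  -- candidates over proper divisors. By `sums`, the exponent in `a n` exceeds it by the candidate
  -- at n. Hence `D ∣ a n`, and the quotient has exactly the candidate exponents.
  cyclotomic-2+ : ∀ m → (∀ {d} → d < 2+ m → .{{_ : NonZero d}} → Cyclotomic d) → Cyclotomic (2+ m)
  cyclotomic-2+ m rec = record
    { value≢0   = subst NonZero (sym φ≡q) q≢0
    ; positive  = λ _ → trans Φ≡q (cong (fromℤ ∘ +_) (sym φ≡q))
    ; valuation = λ {p} pp → trans (cong (ν p) φ≡q) (+-cancelˡ-≡ (ν p D) _ _ (begin
        ν p D + ν p q                      ≡⟨ ν-* p D q ⟨
        ν p (D * q)                        ≡⟨ cong (ν p) (m∣n⇒n≡m*quotient D∣a) ⟨
        ν p (a n)                          ≡⟨ ν-a pp ⟩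
        ν p D + exponent (exponents pp) n  ∎))
    }
    where
    open ≡-Reasoning
    open ExponentSequence
    n = 2+ m
    T = largeDivisors m
    cyclotomics : All (Cyclotomic ∘ toℕ) (properDivisors n)
    cyclotomics = All.map (λ {d} d≢0 → rec (toℕ<n d) {{d≢0}}) (properDivisors-nonZero n)
    D = product (map (φ ∘ toℕ) (properDivisors n))
    D′ = product (map (φ ∘ toℕ) T)
    D≢0,ν-D : ∀ p → NonZero D × ν p D ≡ sum (map (ν p ∘ φ ∘ toℕ) (properDivisors n))
    D≢0,ν-D p = ν-map p (φ ∘ toℕ) (properDivisors n) (All.map Cyclotomic.value≢0 cyclotomics)
    instance
      D≢0 = proj₁ (D≢0,ν-D 0)
      an≢0 = a≢0 n
    ν-a : ∀ {p} (pp : Prime p) → ν p (a n) ≡ ν p D + exponent (exponents pp) n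
    ν-a {p} pp = begin
      ν p (a n)                               ≡⟨ sums (exponents pp) n ⟨
      divisorSum (exponent (exponents pp)) n  ≡⟨ cong (_+ exponent (exponents pp) n) (begin
        sum (map (exponent (exponents pp) ∘ toℕ) (properDivisors n)) ≡⟨ cong sum (map-cong-local (All.map (λ c → Cyclotomic.valuation c pp) cyclotomics)) ⟨
        sum (map (ν p ∘ φ ∘ toℕ) (properDivisors n))                 ≡⟨ proj₂ (D≢0,ν-D p) ⟨
        ν p D                                                        ∎) ⟩
      ν p D + exponent (exponents pp) n       ∎
    D∣a : D ∣ a n
    D∣a = ν≤⇒∣ D (a n) λ p pp → subst (ν p D ≤_) (sym (ν-a pp)) (m≤m+n (ν p D) _)
    q = quotient D∣a
    instance
      q≢0 = quotient≢0 D∣a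
    D≡ : D ≡ a 1 * D′
    D≡ = trans (cong (product ∘ map (φ ∘ toℕ)) (properDivisors-2+ m)) (cong (_* D′) φ₁≡a₁)
    -- Only the divisor 1 contributes a sign, so the denominator has the sign ε of `term n k h` and
    -- the quotient is positive.
    denominator : ℤ
    denominator = term 1 k h ℤ.* + D′
    denominator≡ : denominator ≡ ε ℤ.* + D
    denominator≡ = begin
      term 1 k h ℤ.* + D′        ≡⟨ cong (ℤ._* + D′) (term≡ 1) ⟩
      ε ℤ.* + a 1 ℤ.* + D′       ≡⟨ ℤ.*-assoc ε (+ a 1) (+ D′) ⟩
      ε ℤ.* (+ a 1 ℤ.* + D′)     ≡⟨ cong (ε ℤ.*_) (ℤ.pos-* (a 1) D′) ⟨
      ε ℤ.* + (a 1 * D′)         ≡⟨ cong (λ # → ε ℤ.* + #) D≡ ⟨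
      ε ℤ.* + D                  ∎
    denominator≢0 : denominator ≢ 0ℤ
    denominator≢0 ≡0 with ℤ.i*j≡0⇒i≡0∨j≡0 ε (trans (sym denominator≡) ≡0)
    ... | inj₁ ε≡0 = ≢-nonZero⁻¹ (a 1) {{a≢0 1}} (cong ∣_∣ (trans (term≡ 1) (cong (ℤ._* + a 1) ε≡0)))
    ... | inj₂ D≡0 = ≢-nonZero⁻¹ D (cong ∣_∣ D≡0)
    term≡q*denominator : term n k h ≡ + q ℤ.* denominator
    term≡q*denominator = begin
      term n k h              ≡⟨ term≡ n ⟩
      ε ℤ.* + a n             ≡⟨ cong (λ # → ε ℤ.* + #) (m∣n⇒n≡quotient*m D∣a) ⟩
      ε ℤ.* + (q * D)         ≡⟨ cong (ε ℤ.*_) (ℤ.pos-* q D) ⟩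
      ε ℤ.* (+ q ℤ.* + D)     ≡⟨ ℤ.*-assoc ε (+ q) (+ D) ⟨
      ε ℤ.* + q ℤ.* + D       ≡⟨ cong (ℤ._* + D) (ℤ.*-comm ε (+ q)) ⟩
      + q ℤ.* ε ℤ.* + D       ≡⟨ ℤ.*-assoc (+ q) ε (+ D) ⟩
      + q ℤ.* (ε ℤ.* + D)     ≡⟨ cong (+ q ℤ.*_) denominator≡ ⟨
      + q ℤ.* denominator     ∎
    productΦ≡ : productℚ (map (λ d → Φ (toℕ d) k h) (properDivisors n)) ≡ fromℤ denominator
    productΦ≡ = begin
      productℚ (map (λ d → Φ (toℕ d) k h) (properDivisors n))      ≡⟨ cong (λ ds → productℚ (map (λ d → Φ (toℕ d) k h) ds)) (properDivisors-2+ m) ⟩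
      Φ 1 k h ℚ.* productℚ (map (λ d → Φ (toℕ d) k h) T)           ≡⟨ cong₂ ℚ._*_ Φ₁≡ (productℚ-fromℤ positives) ⟩
      fromℤ (term 1 k h) ℚ.* fromℤ (+ D′)                          ≡⟨ fromℤ-* (term 1 k h) (+ D′) ⟩
      fromℤ denominator                                            ∎
      where
      positives : All (λ d → Φ (toℕ d) k h ≡ fromℤ (+ φ (toℕ d))) T
      positives = All.zipWith (λ (c , d≢1) → Cyclotomic.positive c d≢1)
        (All.tail (subst (All (Cyclotomic ∘ toℕ)) (properDivisors-2+ m) cyclotomics) , largeDivisors-≢1 m)
    Φ≡q : Φ n k h ≡ fromℤ (+ q)
    Φ≡q = begin
      Φ n k h                                                      ≡⟨ Φ-unfold n k h ⟩
      fromℤ (term n k h) ÷₀ productℚ (map (λ d → Φ (toℕ d) k h) (properDivisors n)) ≡⟨ cong₂ (λ t P → fromℤ t ÷₀ P) term≡q*denominator productΦ≡ ⟩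
      fromℤ (+ q ℤ.* denominator) ÷₀ fromℤ denominator             ≡⟨ fromℤ-*-÷₀ (+ q) denominator denominator≢0 ⟩
      fromℤ (+ q)                                                  ∎
    φ≡q : φ n ≡ q
    φ≡q = cong (∣_∣ ∘ ↥_) Φ≡q

  cyclotomic : ∀ n .{{_ : NonZero n}} → Cyclotomic n
  cyclotomic = <-rec (λ n → .{{_ : NonZero n}} → Cyclotomic n) λ where
    1      _   → cyclotomic-1
    (2+ m) rec → cyclotomic-2+ m rec

  -- Comparison of 𝒵 with |Φ_n(k,h)|

  module _ {n : ℕ} .{{n≢0 : NonZero n}} where

    𝒵-primes : All Prime (filter (primitivePrimeDivisor? n k h) (primeFactors (a n)))
    𝒵-primes = filter⁺ (primitivePrimeDivisor? n k h) (primeFactors-prime (a n))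

    instance
      𝒵≢0 : NonZero (𝒵 n k h)
      𝒵≢0 = productOfPrimes≢0 𝒵-primes

      φ≢0 : NonZero (φ n)
      φ≢0 = Cyclotomic.value≢0 (cyclotomic n)

    ν-𝒵-index : ∀ {p} → Prime p → IsPrimitiveIndex p k h n → ν p (𝒵 n k h) ≡ ν p (a n)
    ν-𝒵-index {p} pp i@(_ , p∣a , _) = trans (ν-product p 𝒵-primes)
      (count-filter (primitivePrimeDivisor? n k h) (pp , p∣a , i) (primeFactors (a n)))

    ν-𝒵-other : ∀ {p} → ¬ IsPrimitiveIndex p k h n → ν p (𝒵 n k h) ≡ 0
    ν-𝒵-other {p} ¬i = trans (ν-product p 𝒵-primes)
      (count-filter-∌ (primitivePrimeDivisor? n k h) (¬i ∘ proj₂ ∘ proj₂) (primeFactors (a n)))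

    -- If n is the index of p, both exponents equal that of p in `a n`; otherwise both are 0.
    ν-𝒵≡ν-φ : ∀ {p} → Prime p → (∀ z u → 0 < z → IsPrimitiveIndex p k h u → n ≢ p ^ z * u) →
              ν p (𝒵 n k h) ≡ ν p (φ n)
    ν-𝒵≡ν-φ {p} pp n≢ = trans (ν-𝒵≡ (isPrimitiveIndex? p k h n)) (sym (Cyclotomic.valuation (cyclotomic n) pp))
      where
      open ExponentSequence (exponents pp)
      ν-𝒵≡ : Dec (IsPrimitiveIndex p k h n) → ν p (𝒵 n k h) ≡ exponent n
      ν-𝒵≡ (yes i) = trans (ν-𝒵-index pp i) (sym (at-index i))
      ν-𝒵≡ (no ¬i) = trans (ν-𝒵-other ¬i) (sym (elsewhere n ¬i n≢))

    𝒵≡φ : (∀ p z u → Prime p → 0 < z → IsPrimitiveIndex p k h u → n ≢ p ^ z * u) → 𝒵 n k h ≡ φ n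
    𝒵≡φ n≢ = ν-injective (𝒵 n k h) (φ n) λ p pp → ν-𝒵≡ν-φ pp λ z u → n≢ p z u pp

    -- p divides n = q^w v but not q^w, so it divides v, the index of q, which is less than q. Used
    -- in both directions, this excludes two exceptional primes.
    multiple⇒< : ∀ {p q} z w {u v} → Prime p → Prime q → p ≢ q → 0 < z →
                 IsPrimitiveIndex q k h v → n ≡ p ^ z * u → n ≡ q ^ w * v → p < q
    multiple⇒< {p} {q} (suc z) w {u} {v} pp pq p≢q _ i n≡ n≡′
      with euclidsLemma (q ^ w) v pp (subst (p ∣_) (trans (sym n≡) n≡′) (∣m⇒∣m*n u (m∣m*n (p ^ z))))
    ... | inj₁ p∣q^w = contradiction (prime∣prime⇒≡ pp pq (prime∣^⇒∣ pp q w p∣q^w)) p≢q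
    ... | inj₂ p∣v   = ≤-<-trans (∣⇒≤ {{>-nonZero (proj₁ i)}} p∣v) (index< pq i)

    index<multiple : ∀ {p z u} → Prime p → 0 < z → IsPrimitiveIndex p k h u → n ≡ p ^ z * u → u < n
    index<multiple {p} {z} {u} pp 0<z i n≡ = begin-strict
      u           ≡⟨ *-identityˡ u ⟨
      1 * u       <⟨ *-monoˡ-< u {{>-nonZero (proj₁ i)}} (≤-<-trans 0<z (n<p^n (nonTrivial⇒n>1 p {{prime⇒nonTrivial pp}}) z)) ⟩
      p ^ z * u   ≡⟨ n≡ ⟨
      n           ∎
      where open ≤-Reasoning

    -- At p itself, n exceeds the index u, so 𝒵 contains no p, while Φ_n contains it once because n
    -- ≠ 2. At every other prime the exponents agree, since p is the only exceptional prime.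
    𝒵*p≡φ : ∀ {p z u} → n ≢ 2 → Prime p → 0 < z → IsPrimitiveIndex p k h u → n ≡ p ^ z * u → 𝒵 n k h * p ≡ φ n
    𝒵*p≡φ {p} {z} {u} n≢2 pp 0<z i n≡ = ν-injective (𝒵 n k h * p) (φ n) λ q pq →
      trans (ν-* q (𝒵 n k h) p) (at q pq (p ≟ q))
      where
      instance
        p≢0 = prime⇒nonZero pp
        𝒵*p≢0 = m*n≢0 (𝒵 n k h) p
      ¬index : ¬ IsPrimitiveIndex p k h n
      ¬index j = <⇒≢ (index<multiple pp 0<z i n≡) (index-unique pp i j)
      at : ∀ q → Prime q → Dec (p ≡ q) → ν q (𝒵 n k h) + ν q p ≡ ν q (φ n)
      at q pq (yes refl) = begin
        ν p (𝒵 n k h) + ν p p   ≡⟨ cong₂ _+_ (ν-𝒵-other ¬index) (ν-self pp) ⟩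
        1                       ≡⟨ at-multiple z 0<z i (n≢2 ∘ trans n≡) ⟨
        exponent (p ^ z * u)    ≡⟨ cong exponent n≡ ⟨
        exponent n              ≡⟨ Cyclotomic.valuation (cyclotomic n) pp ⟨
        ν p (φ n)               ∎
        where
        open ≡-Reasoning
        open ExponentSequence (exponents pp)
      -- If q were exceptional too, then p < q and q < p.
      at q pq (no p≢q) = begin
        ν q (𝒵 n k h) + ν q p   ≡⟨ cong (λ # → ν q (𝒵 n k h) + #) (∤⇒ν≡0 p λ q∣p → p≢q (sym (prime∣prime⇒≡ pq pp q∣p))) ⟩
        ν q (𝒵 n k h) + 0       ≡⟨ +-identityʳ _ ⟩
        ν q (𝒵 n k h)           ≡⟨ ν-𝒵≡ν-φ pq (λ w v 0<w j n≡′ → <-asym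
                                     (multiple⇒< z w pp pq p≢q 0<z j n≡ n≡′)
                                     (multiple⇒< w z pq pp (≢-sym p≢q) 0<w i n≡′ n≡)) ⟩
        ν q (φ n)               ∎
        where open ≡-Reasoning

  -- For n = 1 both values are only recorded: whether they agree or are opposite depends on the
  -- order of k and h, which is abstracted here into ε.
  zsigmondy : ∀ n .{{_ : NonZero n}} → n ≢ 2 →
    ((∀ p z u → Prime p → 0 < z → IsPrimitiveIndex p k h u → n ≢ p ^ z * u) →
       fromℤ (+ 𝒵 n k h) ≡ Φ n k h
       ⊎ (n ≡ 1 × fromℤ (+ 𝒵 n k h) ≡ fromℤ (+ (hi ^ 1 ∸ lo ^ 1)) × Φ n k h ≡ fromℤ (term 1 k h)))
    ×
    (∀ p z u → Prime p → 0 < z → IsPrimitiveIndex p k h u → n ≡ p ^ z * u →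
       fromℤ (+ 𝒵 n k h) ≡ Φ n k h ÷₀ fromℤ (+ p))
  zsigmondy n n≢2 = generic , exceptional
    where
    open Cyclotomic (cyclotomic n)
    open ≡-Reasoning
    generic : _ → _
    generic n≢ with n ≟ 1
    ... | no n≢1 = inj₁ (trans (cong (fromℤ ∘ +_) (𝒵≡φ n≢)) (sym (positive n≢1)))
    ... | yes refl = inj₂ (refl , cong (fromℤ ∘ +_) (trans (𝒵≡φ n≢) (trans φ₁≡a₁ (a≡ 1))) , Φ₁≡)
    exceptional : ∀ p z u → Prime p → 0 < z → IsPrimitiveIndex p k h u → n ≡ p ^ z * u →
                  fromℤ (+ 𝒵 n k h) ≡ Φ n k h ÷₀ fromℤ (+ p)
    exceptional p z u pp 0<z i n≡ = begin
      fromℤ (+ 𝒵 n k h)                         ≡⟨ fromℤ-*-÷₀ (+ 𝒵 n k h) (+ p) (≢-nonZero⁻¹ p {{prime⇒nonZero pp}} ∘ cong ∣_∣) ⟨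
      fromℤ (+ 𝒵 n k h ℤ.* + p) ÷₀ fromℤ (+ p)  ≡⟨ cong (λ # → fromℤ # ÷₀ fromℤ (+ p)) (ℤ.pos-* (𝒵 n k h) p) ⟨
      fromℤ (+ (𝒵 n k h * p)) ÷₀ fromℤ (+ p)    ≡⟨ cong (λ # → fromℤ (+ #) ÷₀ fromℤ (+ p)) (𝒵*p≡φ n≢2 pp 0<z i n≡) ⟩
      fromℤ (+ φ n) ÷₀ fromℤ (+ p)              ≡⟨ cong (_÷₀ fromℤ (+ p)) (positive n≢1) ⟨
      Φ n k h ÷₀ fromℤ (+ p)                    ∎
      where
      -- Since 0 < u < n, the value Φ_n is covered by `positive`.
      n≢1 : n ≢ 1
      n≢1 = >⇒≢ (≤-<-trans (proj₁ i) (index<multiple pp 0<z i n≡))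

-- The two orders of k and h

term-≥ : ∀ {k h} → h ≤ k → ∀ n → term n k h ≡ + (k ^ n ∸ h ^ n)
term-≥ {k} {h} h≤k n = trans (ℤ.[+m]-[+n]≡m⊖n (k ^ n) (h ^ n)) (ℤ.⊖-≥ (^-monoˡ-≤ n h≤k))

term-≤ : ∀ {k h} → k ≤ h → ∀ n → term n k h ≡ ℤ.- + (h ^ n ∸ k ^ n)
term-≤ {k} {h} k≤h n = trans (ℤ.[+m]-[+n]≡m⊖n (k ^ n) (h ^ n)) (ℤ.⊖-≤ (^-monoˡ-≤ n k≤h))

-fromℤ-neg : ∀ n → - fromℤ (ℤ.- + n) ≡ fromℤ (+ n)
-fromℤ-neg zero    = refl
-fromℤ-neg (suc n) = refl

≢⇒<∨> : ∀ {m n} → m ≢ n → m < n ⊎ n < m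
≢⇒<∨> {m} {n} m≢n = [ inj₁ ∘ (λ m≤n → ≤∧≢⇒< m≤n m≢n) , inj₂ ∘ (λ n≤m → ≤∧≢⇒< n≤m (≢-sym m≢n)) ]′ (≤-total m n)

-- The extra alternative is a matter of sign: for n = 1 and k < h, Φ_1 = k - h is negative whereas
-- 𝒵, a product of primes, is h - k.
theorem10 : (k h n : ℕ) → .{{_ : NonZero k}} → .{{_ : NonZero h}} → .{{_ : NonZero n}} →
    k ≢ h → gcd k h ≡ 1 → n ≢ 2 →
    ((∀ p z u → Prime p → 0 < z → IsPrimitiveIndex p k h u → n ≢ p ^ z * u) →
    fromℤ (+ 𝒵 n k h) ≡ Φ n k h
    ⊎ (n ≡ 1 × k < h × fromℤ (+ 𝒵 n k h) ≡ - Φ n k h))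
    ×
    (∀ p z u → Prime p → 0 < z → IsPrimitiveIndex p k h u → n ≡ p ^ z * u →
    fromℤ (+ 𝒵 n k h) ≡ Φ n k h ÷₀ fromℤ (+ p))
theorem10 k h n k≢h gcd≡1 n≢2 = [ when-k<h , when-h<k ]′ (≢⇒<∨> k≢h)
  where
  open ≡-Reasoning

  when-k<h : k < h → _
  when-k<h k<h = (λ n≢ → case₁ (proj₁ zsigmondy n≢)) , proj₂ zsigmondy
    where
    zsigmondy = Zsigmondy.zsigmondy k h k h k<h gcd≡1 ℤ.-1ℤ refl
      (λ n → trans (term-≤ (<⇒≤ k<h) n) (sym (ℤ.-1*i≡-i _))) n n≢2
    case₁ : _ ⊎ _ → _
    case₁ (inj₁ 𝒵≡Φ)             = inj₁ 𝒵≡Φ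
    case₁ (inj₂ (n≡1 , 𝒵≡ , Φ≡)) = inj₂ (n≡1 , k<h , (begin
      fromℤ (+ 𝒵 n k h)                   ≡⟨ 𝒵≡ ⟩
      fromℤ (+ (h ^ 1 ∸ k ^ 1))           ≡⟨ -fromℤ-neg (h ^ 1 ∸ k ^ 1) ⟨
      - fromℤ (ℤ.- + (h ^ 1 ∸ k ^ 1))     ≡⟨ cong (-_ ∘ fromℤ) (term-≤ (<⇒≤ k<h) 1) ⟨
      - fromℤ (term 1 k h)                ≡⟨ cong -_ Φ≡ ⟨
      - Φ n k h                           ∎))

  when-h<k : h < k → _
  when-h<k h<k = (λ n≢ → case₁ (proj₁ zsigmondy n≢)) , proj₂ zsigmondy
    where
    zsigmondy = Zsigmondy.zsigmondy k h h k h<k (trans (gcd-comm h k) gcd≡1) ℤ.1ℤ refl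
      (λ n → trans (term-≥ (<⇒≤ h<k) n) (sym (ℤ.*-identityˡ _))) n n≢2
    case₁ : _ ⊎ _ → _
    case₁ (inj₁ 𝒵≡Φ)           = inj₁ 𝒵≡Φ
    -- With h < k the value Φ_1 = k - h is positive, so n = 1 is no exception.
    case₁ (inj₂ (_ , 𝒵≡ , Φ≡)) = inj₁ (begin
      fromℤ (+ 𝒵 n k h)             ≡⟨ 𝒵≡ ⟩
      fromℤ (+ (k ^ 1 ∸ h ^ 1))     ≡⟨ cong fromℤ (term-≥ (<⇒≤ h<k) 1) ⟨
      fromℤ (term 1 k h)            ≡⟨ Φ≡ ⟨
      Φ n k h                       ∎)
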